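{- Let $G$ be a fixed edge-ordered graph with minimal edge $e_0=ab$ such that $G-e_0$ is bipartite and $N_G[a]=N_G[b]$. Then $sat_m(n,G)=O(n\log n)$.
   Context: An edge-ordered graph is a finite simple graph together with a linear order on its edge set (usually given by an injective labeling $l:E\to\mathbb{N}$ or $l:E\to\mathbb{R}$). An edge-ordered graph $H$ contains $G$ (has a copy of $G$) if $G$ is isomorphic, by an isomorphism respecting the edge-order, to a subgraph of $H$ with the induced order; otherwise $H$ is $G$-free. The minimal edge is the edge with the smallest label. $N_G[a]$ denotes the closed neighborhood of $a$ in $G$, and $G-e_0$ is $G$ with the edge $e_0$ deleted (vertices kept). $sat_m(n,G)$ is the minimum number of edges in a $G$-free edge-ordered graph $H$ on $n$ vertices such that adding to $H$ any missing edge, inserted at the beginning of the linear order (i.e. with a label smaller than all labels of $H$), creates a copy of $G$. Asymptotic notation is for $n\to\infty$ with $G$ fixed. -}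

module Defs where

open import Data.Bool using (Bool; T; _∧_; _∨_; not; if_then_else_)
open import Data.Bool.Properties using (T-∨; T-∧; T?; ∨-comm)
open import Data.Fin using (Fin; _<?_; _≟_)
open import Data.List using (length; filter; cartesianProduct; allFin)
open import Data.Nat using (ℕ; suc; _≤_; _<_; _*_)
open import Data.Nat.Properties using (suc-injective)
open import Data.Product using (_×_; _,_; proj₁; proj₂; Σ-syntax; ∃-syntax; swap)
open import Data.Sum using (_⊎_; inj₁; inj₂)
import Data.Sum as Sum
open import Function.Base using (_∘_)
open import Function.Bundles using (module Equivalence)
open import Function.Definitions using (Injective)
open import Level using (0ℓ)
open import Relation.Binary.PropositionalEquality
  using (_≡_; _≢_; refl; sym; trans; cong₂; subst)
open import Relation.Nullary using (Dec; yes; no; ¬_; does; contradiction)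
open import Relation.Nullary.Decidable using (_×-dec_; _⊎-dec_)
open import Relation.Unary using (Pred)

private
  variable
    k n : ℕ

private
  does⇒ : {A : Set} (a? : Dec A) → T (does a?) → A
  does⇒ (yes a) _ = a

  ⇒does : {A : Set} (a? : Dec A) → A → T (does a?)
  ⇒does (yes _) _ = _
  ⇒does (no ¬a) a = ¬a a

-- Equality of the unordered pairs {u , v} and {x , y}.
SamePair : (u v x y : Fin n) → Set
SamePair u v x y = (u ≡ x × v ≡ y) ⊎ (u ≡ y × v ≡ x)

samePair? : (u v x y : Fin n) → Dec (SamePair u v x y)
samePair? u v x y = (u ≟ x ×-dec v ≟ y) ⊎-dec (u ≟ y ×-dec v ≟ x)

samePair-flip : {u v x y : Fin n} → SamePair u v x y → SamePair u v y x
samePair-flip = Sum.swap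

does-samePair?-flip : (u v x y : Fin n) →
                      does (samePair? u v x y) ≡ does (samePair? u v y x)
does-samePair?-flip u v x y =
  ∨-comm (does (u ≟ x ×-dec v ≟ y)) (does (u ≟ y ×-dec v ≟ x))

samePair-join : {u v x y z w : Fin n} →
                SamePair u v x y → SamePair u v z w → SamePair x y z w
samePair-join (inj₁ (refl , refl)) q = q
samePair-join (inj₂ (refl , refl)) q = Sum.swap (Sum.map swap swap q)

record Graph (n : ℕ) : Set where
  field
    adj : Fin n → Fin n → Bool

  Adj : Fin n → Fin n → Set
  Adj u v = T (adj u v)

  field
    adj-sym    : ∀ {u v} → Adj u v → Adj v u
    adj-irrefl : ∀ {v} → ¬ Adj v v

  edgeCount : ℕ
  edgeCount = length (filter (λ (u , v) → u <? v ×-dec T? (adj u v))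
                             (cartesianProduct (allFin n) (allFin n)))

  N[_] : Fin n → Pred (Fin n) 0ℓ
  N[ a ] v = v ≡ a ⊎ Adj a v

  Bipartite : Set
  Bipartite = Σ[ side ∈ (Fin n → Bool) ] (∀ {u v} → Adj u v → side u ≢ side v)

deleteEdge : Graph n → Fin n → Fin n → Graph n
deleteEdge {n} G a b = record
  { adj        = λ x y → adj x y ∧ not (does (samePair? a b x y))
  ; adj-sym    = λ {x} {y} → adj-sym′ x y
  ; adj-irrefl = adj-irrefl ∘ proj₁ ∘ Equivalence.to T-∧
  }
  where
  open Graph G
  adj-sym′ : ∀ x y → T (adj x y ∧ not (does (samePair? a b x y))) →
             T (adj y x ∧ not (does (samePair? a b y x)))
  adj-sym′ x y p with Equivalence.to (T-∧ {adj x y}) p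
  ... | q , r = Equivalence.from T-∧
                  (adj-sym q , subst (T ∘ not) (does-samePair?-flip a b x y) r)

-- Edges are ordered by their labels; the values of label on non-edges play no role.
record EdgeOrderedGraph (n : ℕ) : Set where
  field
    graph : Graph n

  open Graph graph public

  field
    label           : Fin n → Fin n → ℕ
    label-sym       : ∀ u v → label u v ≡ label v u
    label-injective : ∀ {u v x y} → Adj u v → Adj x y →
                      label u v ≡ label x y → SamePair u v x y

  IsMinimalEdge : Fin n → Fin n → Set
  IsMinimalEdge a b = Adj a b × (∀ {u v} → Adj u v → label a b ≤ label u v)

-- The copy is a not necessarily induced subgraph.  Labels are injective on edges,
-- so preserving _<_ between them is the same as preserving and reflecting the order.
Contains : EdgeOrderedGraph n → EdgeOrderedGraph k → Set
Contains {n} {k} H G =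
  Σ[ f ∈ (Fin k → Fin n) ]
    Injective _≡_ _≡_ f
    × (∀ {u v} → G.Adj u v → H.Adj (f u) (f v))
    × (∀ {u v x y} → G.Adj u v → G.Adj x y →
         G.label u v < G.label x y → H.label (f u) (f v) < H.label (f x) (f y))
  where
  module G = EdgeOrderedGraph G
  module H = EdgeOrderedGraph H

-- The edge uv gets label 0 and all other labels are shifted up by one.
insertFirst : (H : EdgeOrderedGraph n) {u v : Fin n} → u ≢ v → EdgeOrderedGraph n
insertFirst {n} H {u} {v} u≢v = record
  { graph = record
    { adj        = adj⁺
    ; adj-sym    = λ {x} {y} → from⁺ ∘ Sum.map samePair-flip adj-sym ∘ to⁺ {x} {y}
    ; adj-irrefl = λ {x} → irrefl⁺ ∘ to⁺ {x} {x}
    }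
  ; label           = label⁺
  ; label-sym       = label⁺-sym
  ; label-injective = λ {x} {y} {z} {w} p q → injective⁺
        (samePair? u v x y) (samePair? u v z w) (to⁺ {x} {y} p) (to⁺ {z} {w} q)
  }
  where
  open EdgeOrderedGraph H

  adj⁺ : Fin n → Fin n → Bool
  adj⁺ x y = does (samePair? u v x y) ∨ adj x y

  label⁺ : Fin n → Fin n → ℕ
  label⁺ x y = if does (samePair? u v x y) then 0 else suc (label x y)

  to⁺ : ∀ {x y} → T (adj⁺ x y) → SamePair u v x y ⊎ Adj x y
  to⁺ {x} {y} = Sum.map₁ (does⇒ (samePair? u v x y)) ∘ Equivalence.to T-∨

  from⁺ : ∀ {x y} → SamePair u v x y ⊎ Adj x y → T (adj⁺ x y)
  from⁺ {x} {y} = Equivalence.from T-∨ ∘ Sum.map₁ (⇒does (samePair? u v x y))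

  irrefl⁺ : ∀ {x} → ¬ (SamePair u v x x ⊎ Adj x x)
  irrefl⁺ (inj₁ (inj₁ (p , q))) = u≢v (trans p (sym q))
  irrefl⁺ (inj₁ (inj₂ (p , q))) = u≢v (trans p (sym q))
  irrefl⁺ (inj₂ p)              = adj-irrefl p

  label⁺-sym : ∀ x y → label⁺ x y ≡ label⁺ y x
  label⁺-sym x y = cong₂ (λ b l → if b then 0 else suc l)
                         (does-samePair?-flip u v x y) (label-sym x y)

  injective⁺ : ∀ {x y z w} (s? : Dec (SamePair u v x y)) (t? : Dec (SamePair u v z w)) →
               SamePair u v x y ⊎ Adj x y → SamePair u v z w ⊎ Adj z w →
               (if does s? then 0 else suc (label x y)) ≡
               (if does t? then 0 else suc (label z w)) →
               SamePair x y z w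
  injective⁺ (yes s) (yes t) p        q        eq = samePair-join s t
  injective⁺ (no ¬s) (no _)  (inj₁ s) q        eq = contradiction s ¬s
  injective⁺ (no _)  (no ¬t) (inj₂ _) (inj₁ t) eq = contradiction t ¬t
  injective⁺ (no _)  (no _)  (inj₂ p) (inj₂ q) eq = label-injective p q (suc-injective eq)

Saturatedₘ : EdgeOrderedGraph k → EdgeOrderedGraph n → Set
Saturatedₘ {k} {n} G H =
  ¬ Contains H G
  × (∀ {u v} (u≢v : u ≢ v) → ¬ Adj u v → Contains (insertFirst H u≢v) G)
  where open EdgeOrderedGraph H

IsMinimum : Pred ℕ 0ℓ → ℕ → Set
IsMinimum P m = P m × (∀ {i} → P i → m ≤ i)

-- m is the number sat_m(n , G).
IsSatₘ : EdgeOrderedGraph k → ℕ → ℕ → Set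
IsSatₘ G n = IsMinimum λ e →
  Σ[ H ∈ EdgeOrderedGraph n ] Saturatedₘ G H × EdgeOrderedGraph.edgeCount H ≡ e

infix 4 _=O_

_=O_ : (ℕ → ℕ) → (ℕ → ℕ) → Set
f =O g = ∃[ C ] ∃[ N ] (∀ n → N ≤ n → f n ≤ C * g n)

{-# OPTIONS --safe #-}
module Submission where

-- If a has a neighbour other than b, take about log n disjoint copies (gadgets) of G − ab, and
-- join each of the remaining vertices to every gadget either as a or as b, according to the
-- binary digits of its number.  This graph is bipartite, while G has a triangle abc, so
-- it is G-free.  Any two remaining vertices differ in some digit, so adding an edge between them
-- completes a copy of G.  If ab is an isolated edge, a single copy of G − ab with isolated
-- remaining vertices does the same job.  Inserting missing edges greedily at the beginning of
-- the order leads to a saturated graph, all of whose edges meet the O(log n) gadget vertices.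
--
-- That the minimum exists constructively needs a search through the edge-ordered graphs on n
-- vertices, which is finite once labels are replaced by their ranks.

open import Defs
open import Data.Bool using (Bool; true; false; T; if_then_else_; _∨_; not)
open import Data.Bool.Properties using (T?; T-∨; T-∧; ¬-not; not-injective)
open import Data.Fin
  using (Fin; zero; suc; toℕ; fromℕ<; _≟_; splitAt; join; _↑ʳ_; remQuot; combine; finToFun;
    funToFin; inject≤)
open import Data.Fin.Properties
  using (any?; all?; toℕ-injective; toℕ-fromℕ<; toℕ<n; splitAt-join; join-splitAt;
    remQuot-combine; combine-remQuot; toℕ-↑ˡ; splitAt⁻¹-↑ˡ; splitAt⁻¹-↑ʳ; splitAt-↑ʳ;
    funToFin-finToFin; inject≤-injective; ¬∀⟶∃¬)
open import Data.List
  using (List; []; _∷_; length; filter; cartesianProduct; allFin; map; tabulate; _++_)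
open import Data.List.Membership.Propositional using (_∈_)
open import Data.List.Membership.Propositional.Properties using (∈-allFin; ∈-cartesianProduct⁺)
open import Data.List.Properties
  using (length-filter; filter-≐; filter-++; filter-none; length-++; length-map; length-tabulate)
import Data.List.Relation.Unary.All as All
import Data.List.Relation.Unary.All.Properties as All
open import Data.List.Relation.Unary.Any using (here; there)
open import Data.Maybe using (Maybe; just; nothing; maybe′)
import Data.Nat as ℕ
open import Data.Nat using (ℕ; zero; suc; _*_; _+_; _≤_; _<_; z≤n; s≤s; _<?_; _∸_; _^_; _⊓_; _⊔_)
open import Data.Nat.Induction using (<-rec)
open import Data.Nat.Logarithm using (⌊log₂_⌋; ⌊log₂⌋-mono-≤; ⌊log₂[2^n]⌋≡n)
open import Data.Nat.Properties hiding (_≟_)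
open import Data.Nat.Tactic.RingSolver using (solve-∀)
open import Data.Product using (_×_; _,_; proj₁; proj₂; Σ-syntax; ∃; ∃-syntax; uncurry)
import Data.Sum as Sum
open import Data.Sum using (_⊎_; inj₁; inj₂; [_,_]′)
import Data.Vec.Functional as Vec
open import Function.Base using (_∘_; id; _$_; flip)
open import Function.Bundles using (module Equivalence)
open import Function.Definitions using (Injective)
open import Level using (0ℓ)
open import Relation.Binary.Core using (Rel)
open import Relation.Binary.Definitions using (_Respects_; Reflexive; tri<; tri≈; tri>)
open import Relation.Binary.PropositionalEquality
open import Relation.Nullary using (Dec; yes; no; ¬_; does; contradiction; _×-dec_; _→-dec_; ¬?)
open import Relation.Nullary.Decidable using (map′; dec-true; dec-false)
open import Relation.Unary using (Pred; Decidable; _⊆_; _≐_)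

private
  variable
    A : Set
    k n : ℕ

-- Counting, least numbers and exhaustive search

module _ {P Q : Pred A 0ℓ} (P? : Decidable P) (Q? : Decidable Q) (P⊆Q : P ⊆ Q) where

  count-mono : ∀ xs → length (filter P? xs) ≤ length (filter Q? xs)
  count-mono []       = z≤n
  count-mono (x ∷ xs) with P? x | Q? x
  ... | yes _ | yes _ = s≤s (count-mono xs)
  ... | yes p | no ¬q = contradiction (P⊆Q p) ¬q
  ... | no _  | yes _ = m≤n⇒m≤1+n (count-mono xs)
  ... | no _  | no _  = count-mono xs

  count-strict-mono : ∀ {x xs} → x ∈ xs → ¬ P x → Q x →
                      length (filter P? xs) < length (filter Q? xs)
  count-strict-mono {x} {_ ∷ xs} (here refl) ¬p q with P? x | Q? x
  ... | yes p | _     = contradiction p ¬p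
  ... | no _  | yes _ = s≤s (count-mono xs)
  ... | no _  | no ¬q = contradiction q ¬q
  count-strict-mono {x} {y ∷ xs} (there x∈xs) ¬p q with P? y | Q? y
  ... | yes _  | yes _  = s≤s (count-strict-mono x∈xs ¬p q)
  ... | yes p′ | no ¬q′ = contradiction (P⊆Q p′) ¬q′
  ... | no _   | yes _  = m≤n⇒m≤1+n (count-strict-mono x∈xs ¬p q)
  ... | no _   | no _   = count-strict-mono x∈xs ¬p q

least : {P : Pred ℕ 0ℓ} → Decidable P → ∀ {e} → P e → ∃[ m ] IsMinimum P m × m ≤ e
least {P} P? {e} = <-rec (λ e → P e → ∃[ m ] IsMinimum P m × m ≤ e) step e
  where
  step : ∀ e → (∀ {i} → i < e → P i → ∃[ m ] IsMinimum P m × m ≤ i) →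
         P e → ∃[ m ] IsMinimum P m × m ≤ e
  step e rec p with anyUpTo? P? e
  ... | yes (i , i<e , q) = let m , min , m≤i = rec i<e q in m , min , ≤-trans m≤i (<⇒≤ i<e)
  ... | no none = e , (p , λ {i} q → ≮⇒≥ (λ i<e → none (i , i<e , q))) , ≤-refl

-- Function types have no decidable equality, hence the restriction to
-- predicates respecting a coarser relation such as pointwise equality.
Searchable : (A : Set) → Rel A 0ℓ → Set₁
Searchable A _≈_ = {P : Pred A 0ℓ} → Decidable P → P Respects _≈_ → Dec (∃ P)

Fin-searchable : Searchable (Fin n) _≡_
Fin-searchable P? _ = any? P?

-- Induction on the size of the domain: search for the value at `zero`, and for each such value for
-- the rest. A function is only pointwise equal to the one reassembled from head and tail, which is
-- where `resp` enters.
→-searchable : {_≈_ : Rel A 0ℓ} → Reflexive _≈_ → Searchable A _≈_ →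
               Searchable (Fin n → A) (λ f g → ∀ i → f i ≈ g i)
→-searchable {n = zero}  rfl s P? resp =
  map′ (λ p → Vec.[] , p) (λ (f , p) → resp (λ ()) p) (P? Vec.[])
→-searchable {n = suc n} rfl s P? resp =
  map′ (λ (a , g , p) → a Vec.∷ g , p)
       (λ (f , p) → f zero , f ∘ suc , resp (λ { zero → rfl ; (suc i) → rfl }) p)
       (s (λ a → →-searchable rfl s (λ g → P? (a Vec.∷ g))
                   (λ f≈g → resp λ { zero → rfl ; (suc i) → f≈g i }))
          (λ a≈b (g , p) → g , resp (λ { zero → a≈b ; (suc i) → rfl }) p))

-- Comparing edge-ordered graphs on the same vertices

infix 4 _⊑_ _≋_

-- Only the relative order of edges is compared, never the label values, since `insertFirst` shifts
-- all labels and the later encoding replaces them by ranks.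
record _⊑_ (H K : EdgeOrderedGraph n) : Set where
  private
    module H = EdgeOrderedGraph H
    module K = EdgeOrderedGraph K
  field
    ⊑-adj   : ∀ {u v} → H.Adj u v → K.Adj u v
    ⊑-order : ∀ {u v x y} → H.Adj u v → H.Adj x y →
              H.label u v < H.label x y → K.label u v < K.label x y

open _⊑_

⊑-refl : {H : EdgeOrderedGraph n} → H ⊑ H
⊑-refl .⊑-adj   = id
⊑-refl .⊑-order = λ _ _ → id

⊑-trans : {H K L : EdgeOrderedGraph n} → H ⊑ K → K ⊑ L → H ⊑ L
⊑-trans p q .⊑-adj         = ⊑-adj q ∘ ⊑-adj p
⊑-trans p q .⊑-order e e′ = ⊑-order q (⊑-adj p e) (⊑-adj p e′) ∘ ⊑-order p e e′

_≋_ : Rel (EdgeOrderedGraph n) 0ℓ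
H ≋ K = H ⊑ K × K ⊑ H

Contains-mono : (G : EdgeOrderedGraph k) {H K : EdgeOrderedGraph n} →
                H ⊑ K → Contains H G → Contains K G
Contains-mono G H⊑K (f , inj , adj , order) =
  f , inj , ⊑-adj H⊑K ∘ adj , λ e e′ → ⊑-order H⊑K (adj e) (adj e′) ∘ order e e′

module InsertFirst (H : EdgeOrderedGraph n) {u v : Fin n} (u≢v : u ≢ v) where
  open EdgeOrderedGraph H
  module I = EdgeOrderedGraph (insertFirst H u≢v)

  new-adj : ∀ {x y} → SamePair u v x y → I.Adj x y
  new-adj {x} {y} s = Equivalence.from (T-∨ {does (samePair? u v x y)})
    (inj₁ (subst T (sym (dec-true (samePair? u v x y) s)) _))

  old-adj : ∀ {x y} → Adj x y → I.Adj x y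
  old-adj {x} {y} p = Equivalence.from (T-∨ {does (samePair? u v x y)}) (inj₂ p)

  adj⁻ : ∀ {x y} → I.Adj x y → SamePair u v x y ⊎ Adj x y
  adj⁻ {x} {y} p with samePair? u v x y
  ... | yes s = inj₁ s
  ... | no ¬s = inj₂ (subst (λ b → T (b ∨ adj x y)) (dec-false (samePair? u v x y) ¬s) p)

  new-label : ∀ {x y} → SamePair u v x y → I.label x y ≡ 0
  new-label {x} {y} s =
    cong (if_then 0 else suc (label x y)) (dec-true (samePair? u v x y) s)

  old-label : ∀ {x y} → ¬ SamePair u v x y → I.label x y ≡ suc (label x y)
  old-label {x} {y} ¬s =
    cong (if_then 0 else suc (label x y)) (dec-false (samePair? u v x y) ¬s)

module _ (H : EdgeOrderedGraph n) {u v : Fin n} (u≢v : u ≢ v) where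
  open EdgeOrderedGraph H
  open InsertFirst H u≢v

  -- Were `u v` already an edge, its label would drop to 0 and could overtake others; all edges
  -- other than the inserted one are shifted alike.
  ⊑-insertFirst : ¬ Adj u v → H ⊑ insertFirst H u≢v
  ⊑-insertFirst ¬uv .⊑-adj = old-adj
  ⊑-insertFirst ¬uv .⊑-order p q lt =
    subst₂ _<_ (sym (old-label (isOld p))) (sym (old-label (isOld q))) (s≤s lt)
    where
    isOld : ∀ {x y} → Adj x y → ¬ SamePair u v x y
    isOld p (inj₁ (refl , refl)) = ¬uv p
    isOld p (inj₂ (refl , refl)) = ¬uv (adj-sym p)

module _ {H K : EdgeOrderedGraph n} (H⊑K : H ⊑ K) {u v u′ v′ : Fin n}
         (u≢v : u ≢ v) (u′≢v′ : u′ ≢ v′) (same : SamePair u v u′ v′) where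
  open EdgeOrderedGraph H
  open InsertFirst H u≢v
  private
    module K = InsertFirst K u′≢v′

    forth : ∀ {x y} → SamePair u v x y → SamePair u′ v′ x y
    forth = samePair-join same

    back : ∀ {x y} → SamePair u′ v′ x y → SamePair u v x y
    back = samePair-join (samePair-join same (inj₁ (refl , refl)))

  -- On both sides the inserted pair gets label 0, even if it was an edge before, and every other
  -- label moves up by one. The two pairs may be listed in opposite directions, as happens in the
  -- greedy procedure.
  insertFirst-mono : insertFirst H u≢v ⊑ insertFirst K u′≢v′
  insertFirst-mono .⊑-adj = [ K.new-adj ∘ forth , K.old-adj ∘ ⊑-adj H⊑K ]′ ∘ adj⁻
  insertFirst-mono .⊑-order {x} {y} {z} {w} p q lt
    with samePair? u v x y | samePair? u v z w
  ... | _ | yes t = contradiction (subst (I.label x y <_) (new-label t) lt) λ ()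
  ... | yes s | no ¬t =
    subst₂ _<_ (sym (K.new-label (forth s))) (sym (K.old-label (¬t ∘ back))) (s≤s z≤n)
  ... | no ¬s | no ¬t =
    subst₂ _<_ (sym (K.old-label (¬s ∘ back))) (sym (K.old-label (¬t ∘ back)))
      (s≤s (⊑-order H⊑K (old p ¬s) (old q ¬t)
             (ℕ.s≤s⁻¹ (subst₂ _<_ (old-label ¬s) (old-label ¬t) lt))))
    where
    old : ∀ {x y} → I.Adj x y → ¬ SamePair u v x y → Adj x y
    old p ¬s = [ flip contradiction ¬s , id ]′ (adj⁻ p)

-- Decidability of containment and saturation

Contains? : (H : EdgeOrderedGraph n) (G : EdgeOrderedGraph k) → Dec (Contains H G)
Contains? {n} {k} H G = →-searchable refl Fin-searchable IsCopy? IsCopy-resp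
  where
  module G = EdgeOrderedGraph G
  module H = EdgeOrderedGraph H

  IsCopy : Pred (Fin k → Fin n) 0ℓ
  IsCopy f = Injective _≡_ _≡_ f
    × (∀ {u v} → G.Adj u v → H.Adj (f u) (f v))
    × (∀ {u v x y} → G.Adj u v → G.Adj x y →
         G.label u v < G.label x y → H.label (f u) (f v) < H.label (f x) (f y))

  IsCopy? : Decidable IsCopy
  IsCopy? f = map′ (λ inj → inj _ _) (λ inj u v → inj)
                (all? λ u → all? λ v → f u ≟ f v →-dec u ≟ v)
    ×-dec map′ (λ h {u} {v} → h u v) (λ h u v → h)
            (all? λ u → all? λ v → T? (G.adj u v) →-dec T? (H.adj (f u) (f v)))
    ×-dec map′ (λ h {u} {v} {x} {y} → h u v x y) (λ h u v x y → h)
            (all? λ u → all? λ v → all? λ x → all? λ y →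
              T? (G.adj u v) →-dec T? (G.adj x y) →-dec
              G.label u v <? G.label x y →-dec H.label (f u) (f v) <? H.label (f x) (f y))

  IsCopy-resp : IsCopy Respects (λ f g → ∀ i → f i ≡ g i)
  IsCopy-resp f≗g (inj , adj , order) =
      (λ gu≡gv → inj (trans (f≗g _) (trans gu≡gv (sym (f≗g _)))))
    , (λ e → subst₂ H.Adj (f≗g _) (f≗g _) (adj e))
    , (λ e e′ lt → subst₂ _<_ (cong₂ H.label (f≗g _) (f≗g _)) (cong₂ H.label (f≗g _) (f≗g _))
                     (order e e′ lt))

Saturatedₘ? : (G : EdgeOrderedGraph k) → Decidable (Saturatedₘ {n = n} G)
Saturatedₘ? G H = ¬? (Contains? H G) ×-dec
  map′ (λ h {u} {v} → h u v) (λ h u v → h) (all? λ u → all? λ v → blocked? u v)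
  where
  open EdgeOrderedGraph H
  blocked? : ∀ u v → Dec (∀ (u≢v : u ≢ v) → ¬ Adj u v → Contains (insertFirst H u≢v) G)
  blocked? u v with u ≟ v
  ... | yes u≡v = yes λ u≢v → contradiction u≡v u≢v
  -- Adjacency and labels of `insertFirst H u≢v` do not mention the proof `u≢v`, so deciding for one
  -- proof decides for all.
  ... | no u≢v  = map′ (λ h _ → h) (_$ u≢v)
                    (¬? (T? (adj u v)) →-dec Contains? (insertFirst H u≢v) G)

edgeCount-resp : {H K : EdgeOrderedGraph n} → H ≋ K →
                 EdgeOrderedGraph.edgeCount H ≡ EdgeOrderedGraph.edgeCount K
edgeCount-resp {n} (H⊑K , K⊑H) = cong length
  (filter-≐ _ _ ((λ (lt , e) → lt , ⊑-adj H⊑K e) , (λ (lt , e) → lt , ⊑-adj K⊑H e))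
    (cartesianProduct (allFin n) (allFin n)))

Saturatedₘ-resp : (G : EdgeOrderedGraph k) → Saturatedₘ {n = n} G Respects _≋_
Saturatedₘ-resp G {H} {K} (H⊑K , K⊑H) (free , sat) =
    free ∘ Contains-mono G K⊑H
  , λ u≢v ¬uv → Contains-mono G (insertFirst-mono H⊑K u≢v u≢v (inj₁ (refl , refl)))
                  (sat u≢v (¬uv ∘ ⊑-adj H⊑K))

-- Finite search through edge-ordered graphs and existence of the minimum

isSuc : Fin (suc n) → Bool
isSuc zero    = false
isSuc (suc _) = true

-- An edge-ordered graph with bounded labels as a matrix of cells, the cell zero
-- marking a non-edge.
Matrix : ℕ → ℕ → Set
Matrix n b = Fin n → Fin n → Fin (suc b)

module _ {n b : ℕ} (c : Matrix n b) where

  IsEdgeOrdered : Set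
  IsEdgeOrdered =
      (∀ u v → c u v ≡ c v u)
    × (∀ v → c v v ≡ zero)
    × (∀ u v x y → T (isSuc (c u v)) → c u v ≡ c x y → SamePair u v x y)

  isEdgeOrdered? : Dec IsEdgeOrdered
  isEdgeOrdered? =
    (all? λ u → all? λ v → c u v ≟ c v u)
    ×-dec (all? λ v → c v v ≟ zero)
    ×-dec (all? λ u → all? λ v → all? λ x → all? λ y →
             T? (isSuc (c u v)) →-dec c u v ≟ c x y →-dec samePair? u v x y)

  decode : IsEdgeOrdered → EdgeOrderedGraph n
  decode (c-sym , c-irrefl , c-inj) = record
    { graph = record
      { adj        = λ u v → isSuc (c u v)
      ; adj-sym    = λ {u} {v} → subst (T ∘ isSuc) (c-sym u v)
      ; adj-irrefl = λ {v} → subst (T ∘ isSuc) (c-irrefl v)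
      }
    ; label           = λ u v → toℕ (c u v)
    ; label-sym       = λ u v → cong toℕ (c-sym u v)
    ; label-injective = λ {u} {v} {x} {y} p _ eq → c-inj u v x y p (toℕ-injective eq)
    }

_≗₂_ : {b : ℕ} → Rel (Matrix n b) 0ℓ
c ≗₂ d = ∀ u v → c u v ≡ d u v

decode-⊑ : {b : ℕ} {c d : Matrix n b} {C : IsEdgeOrdered c} {D : IsEdgeOrdered d} →
           c ≗₂ d → decode c C ⊑ decode d D
decode-⊑ c≗d .⊑-adj            = subst (T ∘ isSuc) (c≗d _ _)
decode-⊑ c≗d .⊑-order _ _ = subst₂ _<_ (cong toℕ (c≗d _ _)) (cong toℕ (c≗d _ _))

decode-≋ : {b : ℕ} {c d : Matrix n b} {C : IsEdgeOrdered c} {D : IsEdgeOrdered d} →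
           c ≗₂ d → decode c C ≋ decode d D
decode-≋ {C = C} {D} c≗d =
  decode-⊑ {C = C} {D} c≗d , decode-⊑ {C = D} {C} (λ u v → sym (c≗d u v))

IsEdgeOrdered-resp : {b : ℕ} → IsEdgeOrdered {n} {b} Respects _≗₂_
IsEdgeOrdered-resp {x = c} {d} c≗d (c-sym , c-irrefl , c-inj) =
    (λ u v → trans (sym (c≗d u v)) (trans (c-sym u v) (c≗d v u)))
  , (λ v → trans (sym (c≗d v v)) (c-irrefl v))
  , (λ u v x y p eq → c-inj u v x y (subst (T ∘ isSuc) (sym (c≗d u v)) p)
                        (trans (c≗d u v) (trans eq (sym (c≗d x y)))))

module _ {n : ℕ} where

  vertexPairs : List (Fin n × Fin n)
  vertexPairs = cartesianProduct (allFin n) (allFin n)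

  ∈-vertexPairs : ∀ u v → (u , v) ∈ vertexPairs
  ∈-vertexPairs u v = ∈-cartesianProduct⁺ (∈-allFin u) (∈-allFin v)

module Encode (H : EdgeOrderedGraph n) where
  open EdgeOrderedGraph H

  below? : ∀ t → Decidable {A = Fin n × Fin n} (λ (x , y) → label x y < t)
  below? t (x , y) = label x y <? t

  -- All vertex pairs are counted, so the ranks are bounded in terms of `n` alone; one finite matrix
  -- type then serves for every graph on `n` vertices.
  rank : ℕ → ℕ
  rank t = length (filter (below? t) vertexPairs)

  rankBound : ℕ
  rankBound = suc (length (vertexPairs {n}))

  rank< : ∀ t → rank t < rankBound
  rank< t = s≤s (length-filter (below? t) vertexPairs)

  rank-mono : ∀ {s t} → s ≤ t → rank s ≤ rank t
  rank-mono s≤t = count-mono (below? _) (below? _) (λ lt → <-≤-trans lt s≤t) vertexPairs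

  -- The pair `(u , v)` itself is counted below `t` but not below its own label.
  rank-strict-mono : ∀ {u v t} → label u v < t → rank (label u v) < rank t
  rank-strict-mono {u} {v} lt = count-strict-mono (below? _) (below? _)
    (λ lt′ → <-trans lt′ lt) (∈-vertexPairs u v) (<-irrefl refl) lt

  rank-reflects-< : ∀ {s t} → rank s < rank t → s < t
  rank-reflects-< lt = ≰⇒> (λ t≤s → <⇒≱ lt (rank-mono t≤s))

  rank-injective : ∀ {u v x y} → rank (label u v) ≡ rank (label x y) → label u v ≡ label x y
  rank-injective {u} {v} {x} {y} eq with <-cmp (label u v) (label x y)
  ... | tri< lt _ _ = contradiction eq (<⇒≢ (rank-strict-mono lt))
  ... | tri≈ _ eq′ _ = eq′
  ... | tri> _ _ gt = contradiction (sym eq) (<⇒≢ (rank-strict-mono gt))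

  cell : Bool → ℕ → Fin (suc rankBound)
  cell b t = if b then suc (fromℕ< (rank< t)) else zero

  isSuc-cell : ∀ b {t} → isSuc (cell b t) ≡ b
  isSuc-cell true  = refl
  isSuc-cell false = refl

  toℕ-cell : ∀ {b t} → T b → toℕ (cell b t) ≡ suc (rank t)
  toℕ-cell {true} {t} _ = cong suc (toℕ-fromℕ< (rank< t))

  encode : Matrix n rankBound
  encode u v = cell (adj u v) (label u v)

  private
    edge : ∀ {u v} → T (isSuc (encode u v)) → Adj u v
    edge = subst T (isSuc-cell _)

    T-ext : ∀ {a b} → (T a → T b) → (T b → T a) → a ≡ b
    T-ext {true}  {true}  _ _ = refl
    T-ext {true}  {false} f _ = contradiction (f _) id
    T-ext {false} {true}  _ g = contradiction (g _) id
    T-ext {false} {false} _ _ = refl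

  encode-isEdgeOrdered : IsEdgeOrdered encode
  encode-isEdgeOrdered = encode-sym , encode-irrefl , encode-inj
    where
    encode-sym : ∀ u v → encode u v ≡ encode v u
    encode-sym u v = cong₂ cell (T-ext adj-sym adj-sym) (label-sym u v)

    encode-irrefl : ∀ v → encode v v ≡ zero
    encode-irrefl v with adj v v | adj-irrefl {v}
    ... | true  | ¬vv = contradiction _ ¬vv
    ... | false | _   = refl

    encode-inj : ∀ u v x y → T (isSuc (encode u v)) → encode u v ≡ encode x y → SamePair u v x y
    encode-inj u v x y p eq = label-injective (edge p) xy (rank-injective (suc-injective
      (trans (sym (toℕ-cell (edge p))) (trans (cong toℕ eq) (toℕ-cell xy)))))
      where
      xy : Adj x y
      xy = edge (subst (T ∘ isSuc) eq p)

  encoded : EdgeOrderedGraph n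
  encoded = decode encode encode-isEdgeOrdered

  encoded-≋ : H ≋ encoded
  encoded-≋ = H⊑ , ⊑H
    where
    H⊑ : H ⊑ encoded
    H⊑ .⊑-adj = subst T (sym (isSuc-cell _))
    H⊑ .⊑-order p q lt =
      subst₂ _<_ (sym (toℕ-cell p)) (sym (toℕ-cell q)) (s≤s (rank-strict-mono lt))

    ⊑H : encoded ⊑ H
    ⊑H .⊑-adj = edge
    ⊑H .⊑-order p q lt =
      rank-reflects-< (ℕ.s≤s⁻¹ (subst₂ _<_ (toℕ-cell (edge p)) (toℕ-cell (edge q)) lt))

-- Up to `≋` every graph is the decoding of its own matrix of ranks, so it is enough to search the
-- matrices.
EdgeOrderedGraph-searchable : Searchable (EdgeOrderedGraph n) _≋_
EdgeOrderedGraph-searchable {n} {P} P? resp =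
  map′ (λ (c , C , p) → decode c C , p)
       (λ (H , p) → Encode.encode H , Encode.encode-isEdgeOrdered H , resp (Encode.encoded-≋ H) p)
       (→-searchable (λ _ → refl) (→-searchable refl Fin-searchable) Q? Q-resp)
  where
  Q : Pred (Matrix n (suc (length (vertexPairs {n})))) 0ℓ
  Q c = Σ[ C ∈ IsEdgeOrdered c ] P (decode c C)

  Q? : Decidable Q
  Q? c with isEdgeOrdered? c
  ... | no ¬C = no (¬C ∘ proj₁)
  -- Different proofs of `IsEdgeOrdered` give decodings that agree up to `≋`, so testing one of them
  -- suffices.
  ... | yes C = map′ (C ,_) (λ (C′ , p) → resp (decode-≋ {C = C′} {C} (λ _ _ → refl)) p)
                  (P? (decode c C))

  Q-resp : Q Respects _≗₂_
  Q-resp c≗d (C , p) = D , resp (decode-≋ {C = C} {D} c≗d) p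
    where D = IsEdgeOrdered-resp c≗d C

satₘ-exists : (G : EdgeOrderedGraph k) {H : EdgeOrderedGraph n} → Saturatedₘ G H →
              ∃[ m ] IsSatₘ G n m × m ≤ EdgeOrderedGraph.edgeCount H
satₘ-exists {n = n} G {H} sat = least attained? (H , sat , refl)
  where
  attained? : Decidable (λ e →
    Σ[ H ∈ EdgeOrderedGraph n ] Saturatedₘ G H × EdgeOrderedGraph.edgeCount H ≡ e)
  attained? e = EdgeOrderedGraph-searchable
    (λ H → Saturatedₘ? G H ×-dec EdgeOrderedGraph.edgeCount H ℕ.≟ e)
    (λ {H} {K} H≋K (sat , count) →
      Saturatedₘ-resp G {H} {K} H≋K sat , trans (sym (edgeCount-resp {H = H} {K} H≋K)) count)

-- Greedy saturation

-- Insert the missing edges one after another, skipping those that would create a copy of G.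
module Greedy (G : EdgeOrderedGraph k) where

  Blocked : EdgeOrderedGraph n → Fin n × Fin n → Set
  Blocked H (u , v) = ∀ (u≢v : u ≢ v) → ¬ EdgeOrderedGraph.Adj H u v →
                      Contains (insertFirst H u≢v) G

  -- The field `new-edges` remembers that each added edge could have been inserted into `H` itself
  -- without creating a copy. Pairs that complete a copy already in `H` therefore remain
  -- non-adjacent unless they were edges of `H`.
  record Extension (H : EdgeOrderedGraph n) : Set where
    field
      host      : EdgeOrderedGraph n
      free      : ¬ Contains host G
      extends   : H ⊑ host
      new-edges : ∀ {u v} (u≢v : u ≢ v) → EdgeOrderedGraph.Adj host u v →
                  EdgeOrderedGraph.Adj H u v ⊎ ¬ Contains (insertFirst H u≢v) G

  open Extension

  -- This is why a single pass over the pairs is enough: a pair skipped once stays blocked while the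
  -- graph grows.
  Blocked-mono : {H K : EdgeOrderedGraph n} → H ⊑ K → ∀ {e} → Blocked H e → Blocked K e
  Blocked-mono {H = H} {K} H⊑K blocked u≢v ¬uv =
    Contains-mono G (insertFirst-mono H⊑K u≢v u≢v (inj₁ (refl , refl)))
      (blocked u≢v (¬uv ∘ ⊑-adj H⊑K))

  extend : (es : List (Fin n × Fin n)) {H : EdgeOrderedGraph n} → ¬ Contains H G →
           Σ[ E ∈ Extension H ] (∀ {e} → e ∈ es → Blocked (host E) e)
  extend [] {H} H-free = record
    { host = H ; free = H-free ; extends = ⊑-refl ; new-edges = λ _ → inj₁ } , λ ()
  extend ((u , v) ∷ es) {H} H-free with u ≟ v | T? (EdgeOrderedGraph.adj H u v)
  ... | yes u≡v | _ = let E , blocked = extend es H-free in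
    E , λ { (here refl) u≢v → contradiction u≡v u≢v ; (there e∈es) → blocked e∈es }
  ... | no _    | yes uv = let E , blocked = extend es H-free in
    E , λ { (here refl) _ ¬uv → contradiction (⊑-adj (extends E) uv) ¬uv
          ; (there e∈es) → blocked e∈es }
  ... | no u≢v  | no ¬uv with Contains? (insertFirst H u≢v) G
  ...   | yes copy = let E , blocked = extend es H-free in
    E , λ { (here refl) → Blocked-mono {H = H} {host E} (extends E) (λ _ _ → copy)
          ; (there e∈es) → blocked e∈es }
  ...   | no ¬copy = let E , blocked = extend es ¬copy in
      record
        { host      = host E
        ; free      = free E
        ; extends   = ⊑-trans H⊑H⁺ (extends E)
        ; new-edges = λ {x} {y} x≢y xy → new x≢y (new-edges E x≢y xy)
        }
    , λ { (here refl) _ ¬uv′ → contradiction (⊑-adj (extends E) (new-adj (inj₁ (refl , refl)))) ¬uv′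
        ; (there e∈es) → blocked e∈es }
    where
    open InsertFirst H u≢v
    H⊑H⁺ : H ⊑ insertFirst H u≢v
    H⊑H⁺ = ⊑-insertFirst H u≢v ¬uv

    new : ∀ {x y} (x≢y : x ≢ y) → I.Adj x y ⊎ ¬ Contains (insertFirst (insertFirst H u≢v) x≢y) G →
          EdgeOrderedGraph.Adj H x y ⊎ ¬ Contains (insertFirst H x≢y) G
    -- An edge added later was harmless even in the larger graph, hence in `H`; the edge `u v`
    -- itself has just been tested.
    new x≢y (inj₂ ¬c) = inj₂
      (¬c ∘ Contains-mono G (insertFirst-mono H⊑H⁺ x≢y x≢y (inj₁ (refl , refl))))
    new x≢y (inj₁ xy) with adj⁻ xy
    ... | inj₂ xy′ = inj₁ xy′
    ... | inj₁ s = inj₂ λ c → ¬copy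
      (Contains-mono G
        (insertFirst-mono (⊑-refl {H = H}) x≢y u≢v (samePair-join s (inj₁ (refl , refl)))) c)

  saturate : {H : EdgeOrderedGraph n} → ¬ Contains H G → Σ[ E ∈ Extension H ] Saturatedₘ G (host E)
  saturate {n} H-free = let E , blocked = extend vertexPairs H-free in
    E , free E , λ {u} {v} → blocked (∈-vertexPairs u v)

-- Bounding the number of edges

count-++ : {P : Pred A 0ℓ} (P? : Decidable P) → ∀ xs ys →
           length (filter P? (xs ++ ys)) ≡ length (filter P? xs) + length (filter P? ys)
count-++ P? xs ys = trans (cong length (filter-++ P? xs ys)) (length-++ (filter P? xs))

module _ {P : Pred A 0ℓ} (P? : Decidable P) where

  private
    fst? : Decidable (P ∘ proj₁ {B = λ _ → A})
    fst? = P? ∘ proj₁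

  count-cartesianProduct : ∀ xs ys →
    length (filter fst? (cartesianProduct xs ys)) ≤ length (filter P? xs) * length ys
  count-cartesianProduct []       ys = z≤n
  count-cartesianProduct (x ∷ xs) ys = ≤-trans
    (≤-reflexive (count-++ fst? (map (x ,_) ys) (cartesianProduct xs ys))) row
    where
    row : length (filter fst? (map (x ,_) ys)) + length (filter fst? (cartesianProduct xs ys))
          ≤ length (filter P? (x ∷ xs)) * length ys
    row with P? x
    ... | yes _ = +-mono-≤ (≤-trans (length-filter fst? (map (x ,_) ys))
                                    (≤-reflexive (length-map (x ,_) ys)))
                           (count-cartesianProduct xs ys)
    ... | no ¬p = +-mono-≤ (≤-reflexive (cong length
                    (filter-none fst? (All.map⁺ (All.universal (λ _ → ¬p) ys)))))
                           (count-cartesianProduct xs ys)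

count-tabulate : {P : Pred A 0ℓ} (P? : Decidable P) (f : Fin n → A) {s : ℕ} →
                 (∀ i → P (f i) → toℕ i < s) → length (filter P? (tabulate f)) ≤ s
count-tabulate {n = zero}  P? f below = z≤n
count-tabulate {n = suc n} P? f {s} below with P? (f zero)
... | no _ = count-tabulate P? (f ∘ suc) (λ i → <-trans (n<1+n _) ∘ below (suc i))
... | yes p with s | below zero p | below
...   | suc s′ | _ | below′ = s≤s (count-tabulate P? (f ∘ suc) (λ i → ℕ.s≤s⁻¹ ∘ below′ (suc i)))

-- `edgeCount` lists every edge once, smaller endpoint first, which leaves at most `s` choices for
-- that endpoint and `n` for the other.
edgeCount≤ : (H : EdgeOrderedGraph n) (let open EdgeOrderedGraph H) (s : ℕ) →
             (∀ {u v} → toℕ u < toℕ v → Adj u v → toℕ u < s) → edgeCount ≤ s * n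
edgeCount≤ {n} H s touches = begin
  edgeCount
    ≤⟨ count-mono _ (below? ∘ proj₁) (λ (lt , e) → touches lt e) vertexPairs ⟩
  length (filter (below? ∘ proj₁) (cartesianProduct (allFin n) (allFin n)))
    ≤⟨ count-cartesianProduct below? (allFin n) (allFin n) ⟩
  length (filter below? (allFin n)) * length (allFin n)
    ≤⟨ *-mono-≤ (count-tabulate below? id (λ _ → id)) (≤-reflexive (length-tabulate {n = n} id)) ⟩
  s * n ∎
  where
  open EdgeOrderedGraph H
  open ≤-Reasoning
  below? : Decidable (λ (u : Fin n) → toℕ u < s)
  below? u = toℕ u <? s

-- Lexicographic labels and breaking ties

bounded : (f : Fin n → ℕ) → ∃[ M ] (∀ i → f i ≤ M)
bounded {zero}  f = 0 , λ ()
bounded {suc n} f = let M , f≤M = bounded (f ∘ suc) in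
  f zero ⊔ M , λ { zero → m≤m⊔n _ _ ; (suc i) → m≤n⇒m≤o⊔n _ (f≤M i) }

-- A larger leading digit in base `d` gains at least `d`, which exceeds the trailing digit `r`.
lex-< : ∀ {d q q′ r r′} → r < d → q < q′ → q * d + r < q′ * d + r′
lex-< {d} {q} {q′} {r} {r′} r<d q<q′ = begin-strict
  q * d + r    <⟨ +-monoʳ-< (q * d) r<d ⟩
  q * d + d    ≡⟨ +-comm (q * d) d ⟩
  suc q * d    ≤⟨ *-monoˡ-≤ d q<q′ ⟩
  q′ * d       ≤⟨ m≤m+n (q′ * d) r′ ⟩
  q′ * d + r′  ∎
  where open ≤-Reasoning

lex-injective : ∀ {d q q′ r r′} → r < d → r′ < d → q * d + r ≡ q′ * d + r′ → q ≡ q′ × r ≡ r′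
lex-injective {d} {q} {q′} r<d r′<d eq with <-cmp q q′
... | tri< lt _ _   = contradiction eq (<⇒≢ (lex-< r<d lt))
... | tri≈ _ refl _ = refl , +-cancelˡ-≡ (q * d) _ _ eq
... | tri> _ _ gt   = contradiction (sym eq) (<⇒≢ (lex-< r′<d gt))

⊓⊔-samePair : {u v x y : Fin n} → toℕ u ⊓ toℕ v ≡ toℕ x ⊓ toℕ y →
              toℕ u ⊔ toℕ v ≡ toℕ x ⊔ toℕ y → SamePair u v x y
⊓⊔-samePair {u = u} {v} {x} {y} eq⊓ eq⊔ with ≤-total (toℕ u) (toℕ v) | ≤-total (toℕ x) (toℕ y)
... | inj₁ u≤v | inj₁ x≤y rewrite m≤n⇒m⊓n≡m u≤v | m≤n⇒m⊓n≡m x≤y | m≤n⇒m⊔n≡n u≤v | m≤n⇒m⊔n≡n x≤y =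
  inj₁ (toℕ-injective eq⊓ , toℕ-injective eq⊔)
... | inj₁ u≤v | inj₂ y≤x rewrite m≤n⇒m⊓n≡m u≤v | m≥n⇒m⊓n≡n y≤x | m≤n⇒m⊔n≡n u≤v | m≥n⇒m⊔n≡m y≤x =
  inj₂ (toℕ-injective eq⊓ , toℕ-injective eq⊔)
... | inj₂ v≤u | inj₁ x≤y rewrite m≥n⇒m⊓n≡n v≤u | m≤n⇒m⊓n≡m x≤y | m≥n⇒m⊔n≡m v≤u | m≤n⇒m⊔n≡n x≤y =
  inj₂ (toℕ-injective eq⊔ , toℕ-injective eq⊓)
... | inj₂ v≤u | inj₂ y≤x rewrite m≥n⇒m⊓n≡n v≤u | m≥n⇒m⊓n≡n y≤x | m≥n⇒m⊔n≡m v≤u | m≥n⇒m⊔n≡m y≤x =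
  inj₁ (toℕ-injective eq⊔ , toℕ-injective eq⊓)

module TieBreak (g : Graph n) (prelabel : Fin n → Fin n → ℕ)
                (prelabel-sym : ∀ u v → prelabel u v ≡ prelabel v u) where

  -- Edges of different gadgets will inherit equal labels from `G`. In base `n` the last two digits
  -- are the smaller and the larger endpoint, which determine the edge, and `prelabel` leads, so its
  -- strict inequalities survive.
  tie-label : Fin n → Fin n → ℕ
  tie-label u v = (prelabel u v * n + (toℕ u ⊓ toℕ v)) * n + (toℕ u ⊔ toℕ v)

  private
    ⊓< : ∀ (u v : Fin n) → toℕ u ⊓ toℕ v < n
    ⊓< u v = ≤-<-trans (m⊓n≤m _ _) (toℕ<n u)

    ⊔< : ∀ (u v : Fin n) → toℕ u ⊔ toℕ v < n
    ⊔< u v = ⊔-lub (toℕ<n u) (toℕ<n v)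

  tieBreak : EdgeOrderedGraph n
  tieBreak = record
    { graph           = g
    ; label           = tie-label
    ; label-sym       = label-sym
    ; label-injective = λ {u} {v} {x} {y} _ _ eq →
        let eq′ , eq⊔ = lex-injective (⊔< u v) (⊔< x y) eq
            _   , eq⊓ = lex-injective {q = prelabel u v} {prelabel x y} (⊓< u v) (⊓< x y) eq′
        in ⊓⊔-samePair eq⊓ eq⊔
    }
    where
    label-sym : ∀ u v → tie-label u v ≡ tie-label v u
    label-sym u v rewrite prelabel-sym u v | ⊓-comm (toℕ u) (toℕ v) | ⊔-comm (toℕ u) (toℕ v) = refl

  tie-label-mono : ∀ {u v x y} → prelabel u v < prelabel x y → tie-label u v < tie-label x y
  tie-label-mono {u} {v} {x} {y} lt = lex-< (⊔< u v) (lex-< (⊓< u v) lt)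

  tie-label-reflects-≤ : ∀ {u v x y} → tie-label u v < tie-label x y → prelabel u v ≤ prelabel x y
  tie-label-reflects-≤ lt = ≮⇒≥ (λ gt → <-asym lt (tie-label-mono gt))

-- Deleting the minimal edge and inserting it again

emptyGraph : EdgeOrderedGraph n
emptyGraph = record
  { graph           = record { adj = λ _ _ → false ; adj-sym = id ; adj-irrefl = id }
  ; label           = λ _ _ → 0
  ; label-sym       = λ _ _ → refl
  ; label-injective = λ ()
  }

label-samePair : (H : EdgeOrderedGraph n) (let open EdgeOrderedGraph H) →
                 ∀ {u v x y} → SamePair u v x y → label u v ≡ label x y
label-samePair H (inj₁ (refl , refl)) = refl
label-samePair H (inj₂ (refl , refl)) = EdgeOrderedGraph.label-sym H _ _

module _ (g : Graph n) (a b : Fin n) where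
  private
    module g  = Graph g
    module g′ = Graph (deleteEdge g a b)

  deleteEdge-adj⁺ : ∀ {x y} → g.Adj x y → ¬ SamePair a b x y → g′.Adj x y
  deleteEdge-adj⁺ {x} {y} xy ¬s =
    Equivalence.from T-∧ (xy , subst (T ∘ not) (sym (dec-false (samePair? a b x y) ¬s)) _)

  deleteEdge-adj⁻ : ∀ {x y} → g′.Adj x y → g.Adj x y × ¬ SamePair a b x y
  deleteEdge-adj⁻ {x} {y} xy =
    let xy′ , t = Equivalence.to (T-∧ {g.adj x y}) xy
    in xy′ , λ s → subst (T ∘ not) (dec-true (samePair? a b x y) s) t

module _ (G : EdgeOrderedGraph k) where
  open EdgeOrderedGraph G

  -- Iterating h on the edge u v would give edges with arbitrarily large labels.
  no-ascending-endomorphism : (h : Fin k → Fin k) →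
    (∀ {u v} → Adj u v → Adj (h u) (h v)) →
    (∀ {u v x y} → Adj u v → Adj x y → label u v < label x y →
                   label (h u) (h v) < label (h x) (h y)) →
    ∀ {u v} → Adj u v → ¬ label u v < label (h u) (h v)
  no-ascending-endomorphism h h-adj h-order {u} {v} uv lt =
    let M , ≤M = bounded (λ x → proj₁ (bounded (label x)))
        x , y , _ , _ , M< = ascend (suc M)
    in <⇒≱ M< (≤-trans (proj₂ (bounded (label x)) y) (≤M x))
    where
    ascend : ∀ i → ∃[ x ] ∃[ y ] Adj x y × label x y < label (h x) (h y) × i ≤ label x y
    ascend zero    = u , v , uv , lt , z≤n
    ascend (suc i) = let x , y , xy , lt , i≤ = ascend i in
      h x , h y , h-adj xy , h-order xy (h-adj xy) lt , ≤-<-trans i≤ lt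

module MinimalEdge (G : EdgeOrderedGraph k) {a b : Fin k}
                   (minimal : EdgeOrderedGraph.IsMinimalEdge G a b) where
  open EdgeOrderedGraph G

  ab : Adj a b
  ab = proj₁ minimal

  a≢b : a ≢ b
  a≢b refl = adj-irrefl ab

  G′ : Graph k
  G′ = deleteEdge graph a b

  module G′ = Graph G′

  -- It is enough to embed `G′`: the edge `ab` goes to the inserted edge, and both come first in
  -- their orders.
  contains-insertFirst : (H : EdgeOrderedGraph n) (let module H = EdgeOrderedGraph H)
    (f : Fin k → Fin n) → Injective _≡_ _≡_ f →
    ∀ {p q} (p≢q : p ≢ q) → SamePair p q (f a) (f b) →
    (∀ {x y} → G′.Adj x y → H.Adj (f x) (f y)) →
    (∀ {x y z w} → G′.Adj x y → G′.Adj z w → label x y < label z w →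
                   H.label (f x) (f y) < H.label (f z) (f w)) →
    Contains (insertFirst H p≢q) G
  contains-insertFirst H f inj {p} {q} p≢q same f-adj f-order = f , inj , copy-adj , copy-order
    where
    module H = EdgeOrderedGraph H
    open InsertFirst H p≢q

    forth : ∀ {x y} → SamePair a b x y → SamePair p q (f x) (f y)
    forth (inj₁ (refl , refl)) = same
    forth (inj₂ (refl , refl)) = samePair-flip same

    back : ∀ {x y} → SamePair p q (f x) (f y) → SamePair a b x y
    back s = Sum.map (λ (e , e′) → inj e , inj e′) (λ (e , e′) → inj e , inj e′)
               (samePair-join same s)

    copy-adj : ∀ {x y} → Adj x y → I.Adj (f x) (f y)
    copy-adj {x} {y} xy with samePair? a b x y
    ... | yes s = new-adj (forth s)
    ... | no ¬s = old-adj (f-adj (deleteEdge-adj⁺ graph a b xy ¬s))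

    copy-order : ∀ {x y z w} → Adj x y → Adj z w → label x y < label z w →
                 I.label (f x) (f y) < I.label (f z) (f w)
    copy-order {x} {y} {z} {w} xy zw lt with samePair? a b x y | samePair? a b z w
    ... | _ | yes t = contradiction (proj₂ minimal xy)
                        (<⇒≱ (subst (label x y <_) (sym (label-samePair G t)) lt))
    ... | yes s | no ¬t =
      subst₂ _<_ (sym (new-label (forth s))) (sym (old-label (¬t ∘ back))) (s≤s z≤n)
    ... | no ¬s | no ¬t = subst₂ _<_ (sym (old-label (¬s ∘ back))) (sym (old-label (¬t ∘ back)))
      (s≤s (f-order (deleteEdge-adj⁺ graph a b xy ¬s) (deleteEdge-adj⁺ graph a b zw ¬t) lt))

  emptyGraph-free : ¬ Contains (emptyGraph {n}) G
  emptyGraph-free (_ , _ , adj , _) = adj ab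

  -- The host graph made of gadgets

  -- L disjoint copies ("gadgets") of G′ and m further vertices, the u-th of which is joined
  -- to gadget j just as the vertex role u j of that gadget is.
  module Host (L m : ℕ) (role : Fin m → Fin L → Fin k) where

    Site : Set
    Site = (Fin L × Fin k) ⊎ Fin m

    -- Gadget vertices are numbered first, so an edge meets a gadget exactly when its smaller
    -- endpoint is below `L * k`, the form that `edgeCount≤` asks for.
    site : Fin (L * k + m) → Site
    site = Sum.map₁ (remQuot k) ∘ splitAt (L * k)

    vertex : Site → Fin (L * k + m)
    vertex = join (L * k) m ∘ Sum.map₁ (uncurry combine)

    site-vertex : ∀ s → site (vertex s) ≡ s
    site-vertex s rewrite splitAt-join (L * k) m (Sum.map₁ (uncurry combine) s) with s
    ... | inj₁ (j , w) = cong inj₁ (remQuot-combine j w)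
    ... | inj₂ _       = refl

    vertex-site : ∀ x → vertex (site x) ≡ x
    vertex-site x = trans (cong (join (L * k) m) (lemma (splitAt (L * k) x)))
                          (join-splitAt (L * k) m x)
      where
      lemma : ∀ s → Sum.map₁ (uncurry combine) (Sum.map₁ (remQuot {L} k) s) ≡ s
      lemma (inj₁ i) = cong inj₁ (combine-remQuot {L} k i)
      lemma (inj₂ _) = refl

    -- The gadget responsible for a pair of sites. The value `nothing` keeps distinct gadgets, and
    -- any two further vertices, non-adjacent.
    gadget : Site → Site → Maybe (Fin L)
    gadget (inj₁ (i , _)) (inj₁ (j , _)) = if does (i ≟ j) then just i else nothing
    gadget (inj₁ (j , _)) (inj₂ _)       = just j
    gadget (inj₂ _)       (inj₁ (j , _)) = just j
    gadget (inj₂ _)       (inj₂ _)       = nothing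

    gadget-sym : ∀ s t → gadget s t ≡ gadget t s
    gadget-sym (inj₁ (i , _)) (inj₁ (j , _)) with i ≟ j | j ≟ i
    ... | yes refl | yes _  = refl
    ... | yes refl | no ¬eq = contradiction refl ¬eq
    ... | no ¬eq   | yes eq = contradiction (sym eq) ¬eq
    ... | no _     | no _   = refl
    gadget-sym (inj₁ _) (inj₂ _) = refl
    gadget-sym (inj₂ _) (inj₁ _) = refl
    gadget-sym (inj₂ _) (inj₂ _) = refl

    roleIn : Fin L → Site → Fin k
    roleIn j (inj₁ (_ , w)) = w
    roleIn j (inj₂ u)       = role u j

    siteAdj : Site → Site → Bool
    siteAdj s t = maybe′ (λ j → G′.adj (roleIn j s) (roleIn j t)) false (gadget s t)

    siteLabel : Site → Site → ℕ
    siteLabel s t = maybe′ (λ j → label (roleIn j s) (roleIn j t)) 0 (gadget s t)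

    siteAdj⁻ : ∀ s t → T (siteAdj s t) →
               ∃[ j ] gadget s t ≡ just j × G′.Adj (roleIn j s) (roleIn j t)
    siteAdj⁻ s t e with gadget s t
    ... | just j = j , refl , e

    siteAdj⁺ : ∀ s t {j} → gadget s t ≡ just j → G′.Adj (roleIn j s) (roleIn j t) → T (siteAdj s t)
    siteAdj⁺ s t eq e rewrite eq = e

    siteLabel≡ : ∀ s t {j} → gadget s t ≡ just j → siteLabel s t ≡ label (roleIn j s) (roleIn j t)
    siteLabel≡ s t eq rewrite eq = refl

    hostGraph : Graph (L * k + m)
    hostGraph = record
      { adj        = λ x y → siteAdj (site x) (site y)
      ; adj-sym    = λ {x} {y} e → let j , eq , e′ = siteAdj⁻ (site x) (site y) e in
          siteAdj⁺ (site y) (site x) (trans (gadget-sym (site y) (site x)) eq) (G′.adj-sym e′)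
      ; adj-irrefl = λ {x} e → let j , _ , e′ = siteAdj⁻ (site x) (site x) e in G′.adj-irrefl e′
      }

    siteLabel-sym : ∀ s t → siteLabel s t ≡ siteLabel t s
    siteLabel-sym s t rewrite gadget-sym s t with gadget t s
    ... | just j  = label-sym (roleIn j s) (roleIn j t)
    ... | nothing = refl

    open TieBreak hostGraph (λ x y → siteLabel (site x) (site y))
      (λ x y → siteLabel-sym (site x) (site y)) public

    host : EdgeOrderedGraph (L * k + m)
    host = tieBreak

    module host = EdgeOrderedGraph host

    -- The copy is gadget `j` with `u` in place of `a` and `v` in place of `b`. The conditions on
    -- the roles only bind when `a` or `b` has a neighbour in `G′`, so they are vacuous if `ab` is
    -- an isolated edge.
    module Copy (j : Fin L) {u v : Fin m} (u≢v : u ≢ v)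
      (u-role : ∀ {w} → G′.Adj a w → role u j ≡ a)
      (v-role : ∀ {w} → G′.Adj b w → role v j ≡ b) where

      place : ∀ {w} → Dec (w ≡ a) → Dec (w ≡ b) → Site
      place {w} (yes _) _       = inj₂ u
      place {w} (no _)  (yes _) = inj₂ v
      place {w} (no _)  (no _)  = inj₁ (j , w)

      copySite : Fin k → Site
      copySite w = place (w ≟ a) (w ≟ b)

      copySite-a : copySite a ≡ inj₂ u
      copySite-a = lemma (a ≟ a)
        where
        lemma : ∀ p? → place p? (a ≟ b) ≡ inj₂ u
        lemma (yes _) = refl
        lemma (no ¬p) = contradiction refl ¬p

      copySite-b : copySite b ≡ inj₂ v
      copySite-b = lemma (b ≟ a) (b ≟ b)
        where
        lemma : ∀ p? q? → place p? q? ≡ inj₂ v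
        lemma (yes p) _       = contradiction (sym p) a≢b
        lemma (no _)  (yes _) = refl
        lemma (no _)  (no ¬q) = contradiction refl ¬q

      copySite-injective : ∀ {w w′} → copySite w ≡ copySite w′ → w ≡ w′
      copySite-injective {w} {w′} = lemma (w ≟ a) (w ≟ b) (w′ ≟ a) (w′ ≟ b)
        where
        lemma : ∀ p? q? p′? q′? → place {w} p? q? ≡ place {w′} p′? q′? → w ≡ w′
        lemma (yes p) _       (yes p′) _        eq   = trans p (sym p′)
        lemma (yes _) _       (no _)   (yes _)  refl = contradiction refl u≢v
        lemma (no _)  (yes _) (yes _)  _        refl = contradiction refl u≢v
        lemma (no _)  (yes q) (no _)   (yes q′) eq   = trans q (sym q′)
        lemma (no _)  (no _)  (no _)   (no _)   refl = refl

      roleIn-copySite : ∀ {x y} → G′.Adj x y → roleIn j (copySite x) ≡ x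
      roleIn-copySite {x} xy = lemma (x ≟ a) (x ≟ b)
        where
        lemma : ∀ p? q? → roleIn j (place {x} p? q?) ≡ x
        lemma (yes refl) _          = u-role xy
        lemma (no _)     (yes refl) = v-role xy
        lemma (no _)     (no _)     = refl

      gadget-copySite : ∀ {x y} → G′.Adj x y → gadget (copySite x) (copySite y) ≡ just j
      gadget-copySite {x} {y} xy = lemma (x ≟ a) (x ≟ b) (y ≟ a) (y ≟ b)
        where
        lemma : ∀ p? q? p′? q′? → gadget (place {x} p? q?) (place {y} p′? q′?) ≡ just j
        -- If both endpoints were placed outside the gadget, the edge `xy` of `G′` would be a loop
        -- or the deleted edge.
        lemma (yes refl) _ (yes refl) _ = contradiction xy G′.adj-irrefl
        lemma (yes refl) _ (no _) (yes refl) =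
          contradiction (inj₁ (refl , refl)) (proj₂ (deleteEdge-adj⁻ graph a b xy))
        lemma (no _) (yes refl) (yes refl) _ =
          contradiction (inj₂ (refl , refl)) (proj₂ (deleteEdge-adj⁻ graph a b xy))
        lemma (no _) (yes refl) (no _) (yes refl) = contradiction xy G′.adj-irrefl
        lemma (yes _) _       (no _)  (no _)  = refl
        lemma (no _)  (yes _) (no _)  (no _)  = refl
        lemma (no _)  (no _)  (yes _) _       = refl
        lemma (no _)  (no _)  (no _)  (yes _) = refl
        lemma (no _)  (no _)  (no _)  (no _)  =
          cong (if_then just j else nothing) (dec-true (j ≟ j) refl)

      copy : Fin k → Fin (L * k + m)
      copy = vertex ∘ copySite

      copy-injective : Injective _≡_ _≡_ copy
      copy-injective {x} {y} eq = copySite-injective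
        (trans (sym (site-vertex (copySite x))) (trans (cong site eq) (site-vertex (copySite y))))

      copy-adj : ∀ {x y} → G′.Adj x y → host.Adj (copy x) (copy y)
      copy-adj {x} {y} xy rewrite site-vertex (copySite x) | site-vertex (copySite y) =
        siteAdj⁺ (copySite x) (copySite y) (gadget-copySite xy)
          (subst₂ G′.Adj {x} {_} {y} (sym (roleIn-copySite xy))
            (sym (roleIn-copySite (G′.adj-sym {x} {y} xy))) xy)

      copy-prelabel : ∀ {x y} → G′.Adj x y → siteLabel (site (copy x)) (site (copy y)) ≡ label x y
      copy-prelabel {x} {y} xy rewrite site-vertex (copySite x) | site-vertex (copySite y) =
        trans (siteLabel≡ (copySite x) (copySite y) (gadget-copySite xy))
              (cong₂ label (roleIn-copySite xy) (roleIn-copySite (G′.adj-sym xy)))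

      insertFirst-copy : ∀ {p q} (p≢q : p ≢ q) →
        SamePair p q (vertex (inj₂ u)) (vertex (inj₂ v)) → Contains (insertFirst host p≢q) G
      insertFirst-copy p≢q same = contains-insertFirst host copy copy-injective p≢q
        (subst₂ (λ s t → SamePair _ _ (vertex s) (vertex t)) (sym copySite-a) (sym copySite-b) same)
        copy-adj
        (λ xy zw lt → tie-label-mono
          (subst₂ _<_ (sym (copy-prelabel xy)) (sym (copy-prelabel zw)) lt))

    PlaysTheEnds : Fin L → Fin m → Fin m → Set
    PlaysTheEnds j u v = (∀ {w} → G′.Adj a w → role u j ≡ a)
                       × (∀ {w} → G′.Adj b w → role v j ≡ b)

    -- Joining two outside vertices of the host already completes a copy of `G`, so the greedy
    -- procedure never joins them, and every edge of the result keeps an endpoint in a gadget.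
    sparse-saturated : ¬ Contains host G →
      (∀ {u v} → u ≢ v → ∃[ j ] (PlaysTheEnds j u v ⊎ PlaysTheEnds j v u)) →
      Σ[ H ∈ EdgeOrderedGraph (L * k + m) ]
        Saturatedₘ G H × EdgeOrderedGraph.edgeCount H ≤ L * k * (L * k + m)
    sparse-saturated host-free separated =
      let E , sat = saturate host-free in
      Extension.host E , sat , edgeCount≤ (Extension.host E) (L * k) (touches E)
      where
      open Greedy G

      outside : Fin m → Fin (L * k + m)
      outside u = L * k ↑ʳ u

      locate : ∀ x → toℕ x < L * k ⊎ (∃[ u ] outside u ≡ x)
      locate x with splitAt (L * k) x in eq
      ... | inj₁ i = inj₁ (subst (_< L * k)
        (trans (sym (toℕ-↑ˡ i m)) (cong toℕ (splitAt⁻¹-↑ˡ eq))) (toℕ<n i))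
      ... | inj₂ u = inj₂ (u , splitAt⁻¹-↑ʳ eq)

      outside-nonadjacent : ∀ u v → ¬ host.Adj (outside u) (outside v)
      outside-nonadjacent u v e rewrite splitAt-↑ʳ (L * k) m u | splitAt-↑ʳ (L * k) m v = e

      outside-copy : ∀ {u v} (u≢v : outside u ≢ outside v) → Contains (insertFirst host u≢v) G
      outside-copy u≢v with separated (u≢v ∘ cong outside)
      ... | j , inj₁ (ru , rv) =
        Copy.insertFirst-copy j (u≢v ∘ cong outside) ru rv u≢v (inj₁ (refl , refl))
      ... | j , inj₂ (rv , ru) =
        Copy.insertFirst-copy j (u≢v ∘ cong outside ∘ sym) rv ru u≢v (inj₂ (refl , refl))

      touches : (E : Extension host) → ∀ {x y} → toℕ x < toℕ y →
                EdgeOrderedGraph.Adj (Extension.host E) x y → toℕ x < L * k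
      touches E {x} {y} x<y xy with locate x | locate y
      ... | inj₁ x<Lk | _         = x<Lk
      ... | inj₂ _    | inj₁ y<Lk = <-trans x<y y<Lk
      ... | inj₂ (u , refl) | inj₂ (v , refl) =
        contradiction (Extension.new-edges E x≢y xy)
          [ outside-nonadjacent u v , contradiction (outside-copy x≢y) ]′
        where
        x≢y : outside u ≢ outside v
        x≢y eq = <-irrefl (cong toℕ eq) x<y

  -- The case of an isolated minimal edge

  -- A copy of G in the host would retract to an endomorphism of G mapping ab to a later edge.
  module Isolated (isolated : ∀ {x} → ¬ G′.Adj a x) (m : ℕ) where
    open Host 1 m (λ _ _ → a)

    retract : Fin (1 * k + m) → Fin k
    retract = roleIn zero ∘ site

    -- All outside vertices play `a`, which has no neighbour in `G′`.
    siteAdj-inside : ∀ s t → T (siteAdj s t) →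
                     ∃[ v ] ∃[ w ] s ≡ inj₁ (zero , v) × t ≡ inj₁ (zero , w)
    siteAdj-inside (inj₁ (zero , v)) (inj₁ (zero , w)) e = v , w , refl , refl
    siteAdj-inside (inj₁ _) (inj₂ _) e = contradiction (G′.adj-sym e) isolated
    siteAdj-inside (inj₂ _) (inj₁ _) e = contradiction e isolated

    inside : ∀ {x y} → host.Adj x y →
             x ≡ vertex (inj₁ (zero , retract x)) × y ≡ vertex (inj₁ (zero , retract y))
    inside {x} {y} xy with site x in eqx | site y in eqy | siteAdj-inside (site x) (site y) xy
    ... | _ | _ | v , w , refl , refl =
      trans (sym (vertex-site x)) (cong vertex eqx) , trans (sym (vertex-site y)) (cong vertex eqy)

    retract-adj : ∀ {x y} → host.Adj x y → G′.Adj (retract x) (retract y)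
    retract-adj {x} {y} xy with siteAdj⁻ (site x) (site y) xy
    ... | zero , _ , e = e

    retract-label : ∀ {x y} → host.Adj x y →
                    siteLabel (site x) (site y) ≡ label (retract x) (retract y)
    retract-label {x} {y} xy with siteAdj⁻ (site x) (site y) xy
    ... | zero , eq , _ = siteLabel≡ (site x) (site y) eq

    -- Tie-breaking reflects only the weak inequality. If the retracted labels were equal, the
    -- retracted edges would coincide; with a single gadget the host edges would then coincide too,
    -- against `lt`.
    retract-order : ∀ {x y z w} → host.Adj x y → host.Adj z w →
                    host.label x y < host.label z w →
                    label (retract x) (retract y) < label (retract z) (retract w)
    retract-order {x} {y} {z} {w} xy zw lt = ≤∧≢⇒<
      (subst₂ _≤_ (retract-label xy) (retract-label zw) (tie-label-reflects-≤ lt))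
      (λ eq → <-irrefl (label-samePair host (same (label-injective (edge xy) (edge zw) eq))) lt)
      where
      edge : ∀ {x y} → host.Adj x y → Adj (retract x) (retract y)
      edge xy = proj₁ (deleteEdge-adj⁻ graph a b (retract-adj xy))

      glue : ∀ {x y} → x ≡ vertex (inj₁ (zero , retract x)) →
             y ≡ vertex (inj₁ (zero , retract y)) →
             retract x ≡ retract y → x ≡ y
      glue ex ey eq = trans ex (trans (cong (λ v → vertex (inj₁ (zero , v))) eq) (sym ey))

      same : SamePair (retract x) (retract y) (retract z) (retract w) → SamePair x y z w
      same = let ex , ey = inside xy ; ez , ew = inside zw in
        Sum.map (λ (p , q) → glue ex ez p , glue ey ew q) (λ (p , q) → glue ex ew p , glue ey ez q)

    host-free : ¬ Contains host G
    host-free (f , _ , f-adj , f-order) =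
      no-ascending-endomorphism G (retract ∘ f) h-adj
        (λ e e′ → retract-order (f-adj e) (f-adj e′) ∘ f-order e e′) ab
        -- The image of `ab` is an edge of `G′`, hence different from `ab`, and by minimality it
        -- comes strictly later.
        (≤∧≢⇒< (proj₂ minimal (h-adj ab))
               (proj₂ (deleteEdge-adj⁻ graph a b (retract-adj (f-adj ab)))
                 ∘ label-injective ab (h-adj ab)))
      where
      h-adj : ∀ {u v} → Adj u v → Adj (retract (f u)) (retract (f v))
      h-adj e = proj₁ (deleteEdge-adj⁻ graph a b (retract-adj (f-adj e)))

  -- The case of a triangle on the minimal edge

  module Triangle (G′-bipartite : Graph.Bipartite G′) {c : Fin k}
                  (ac : Adj a c) (bc : Adj b c) where

    a≢c : a ≢ c
    a≢c refl = adj-irrefl ac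

    b≢c : b ≢ c
    b≢c refl = adj-irrefl bc

    side : Fin k → Bool
    side = proj₁ G′-bipartite

    -- Both are opposite to their common neighbour `c` in `G′`.
    side-a≡side-b : side a ≡ side b
    side-a≡side-b = trans (¬-not (proj₂ G′-bipartite ac′)) (sym (¬-not (proj₂ G′-bipartite bc′)))
      where
      ac′ : G′.Adj a c
      ac′ = deleteEdge-adj⁺ graph a b ac λ
        { (inj₁ (_ , b≡c)) → b≢c b≡c ; (inj₂ (a≡c , _)) → a≢c a≡c }
      bc′ : G′.Adj b c
      bc′ = deleteEdge-adj⁺ graph a b bc λ
        { (inj₁ (a≡b , _)) → a≢b a≡b ; (inj₂ (a≡c , _)) → a≢c a≡c }

    module _ {L m : ℕ} (role : Fin m → Fin L → Fin k)
             (role-side : ∀ u j → side (role u j) ≡ side a) where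
      open Host L m role

      -- A further vertex plays `a` or `b` depending on the gadget, but these lie on the same side,
      -- so the sides of the gadgets fit together into one bipartition.
      siteSide : Site → Bool
      siteSide (inj₁ (_ , w)) = side w
      siteSide (inj₂ _)       = side a

      roleIn-side : ∀ j s → side (roleIn j s) ≡ siteSide s
      roleIn-side j (inj₁ _) = refl
      roleIn-side j (inj₂ u) = role-side u j

      host-bipartite : ∀ {x y} → host.Adj x y → siteSide (site x) ≢ siteSide (site y)
      host-bipartite {x} {y} xy eq with siteAdj⁻ (site x) (site y) xy
      ... | j , _ , e = proj₂ G′-bipartite e
        (trans (roleIn-side j (site x)) (trans eq (sym (roleIn-side j (site y)))))

      -- The images of `b` and `c` are both opposite to that of `a`, hence on one side, although
      -- they are adjacent.
      host-free : ¬ Contains host G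
      host-free (f , _ , f-adj , _) = host-bipartite (f-adj bc) (not-injective
        (trans (sym (¬-not (host-bipartite (f-adj ab)))) (¬-not (host-bipartite (f-adj ac)))))

    module _ {L m : ℕ} (m≤2^L : m ≤ 2 ^ L) where

      -- The binary digits of the number `u`, read through the bijection between `Fin (2 ^ L)` and
      -- `Fin L → Fin 2`.
      digit : Fin m → Fin L → Fin 2
      digit u = finToFun (inject≤ u m≤2^L)

      digits-differ : ∀ {u v} → u ≢ v → ∃[ j ] digit u j ≢ digit v j
      digits-differ {u} {v} u≢v = ¬∀⟶∃¬ L _ (λ j → digit u j ≟ digit v j) λ eq →
        u≢v (inject≤-injective m≤2^L m≤2^L u v
          (trans (sym (funToFin-finToFin {L} (inject≤ u m≤2^L)))
            (trans (funToFin-cong eq) (funToFin-finToFin {L} (inject≤ v m≤2^L)))))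
        where
        funToFin-cong : ∀ {l} {f g : Fin l → Fin 2} → (∀ i → f i ≡ g i) → funToFin f ≡ funToFin g
        funToFin-cong {zero}  _   = refl
        funToFin-cong {suc l} f≗g = cong₂ combine (f≗g zero) (funToFin-cong (f≗g ∘ suc))

      end : Fin 2 → Fin k
      end zero    = a
      end (suc _) = b

      role : Fin m → Fin L → Fin k
      role u j = end (digit u j)

      role-side : ∀ u j → side (role u j) ≡ side a
      role-side u j with digit u j
      ... | zero  = refl
      ... | suc _ = sym side-a≡side-b

      open Host L m role

      -- At a digit where the numbers differ, one vertex plays `a` and the other `b`; which is which
      -- depends on the digits, hence the two alternatives.
      separated : ∀ {u v} → u ≢ v → ∃[ j ] (PlaysTheEnds j u v ⊎ PlaysTheEnds j v u)
      separated {u} {v} u≢v with digits-differ u≢v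
      ... | j , differ = j , lemma (digit u j) (digit v j) differ
        where
        Ends : Fin 2 → Fin 2 → Set
        Ends d e = (∀ {w} → G′.Adj a w → end d ≡ a) × (∀ {w} → G′.Adj b w → end e ≡ b)
        lemma : ∀ d e → d ≢ e → Ends d e ⊎ Ends e d
        lemma zero       zero       d≢e = contradiction refl d≢e
        lemma zero       (suc _)    _   = inj₁ ((λ _ → refl) , (λ _ → refl))
        lemma (suc _)    zero       _   = inj₂ ((λ _ → refl) , (λ _ → refl))
        lemma (suc zero) (suc zero) d≢e = contradiction refl d≢e

      triangle-saturated : Σ[ H ∈ EdgeOrderedGraph (L * k + m) ]
        Saturatedₘ G H × EdgeOrderedGraph.edgeCount H ≤ L * k * (L * k + m)
      triangle-saturated = sparse-saturated (host-free role role-side) separated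

-- Choice of the number of gadgets and the final bound

n<2^[1+⌊log₂n⌋] : ∀ n → n < 2 ^ suc ⌊log₂ n ⌋
n<2^[1+⌊log₂n⌋] n = ≰⇒> λ 2^≤n → 1+n≰n
  (subst (_≤ ⌊log₂ n ⌋) (⌊log₂[2^n]⌋≡n (suc ⌊log₂ n ⌋)) (⌊log₂⌋-mono-≤ 2^≤n))

theorem8 : ∀ {k : ℕ} (G : EdgeOrderedGraph k) (a b : Fin k) →
    let open EdgeOrderedGraph G in
    IsMinimalEdge a b →
    Graph.Bipartite (deleteEdge graph a b) →
    N[ a ] ≐ N[ b ] →
    Σ[ sat ∈ (ℕ → ℕ) ]
    (∀ n → IsSatₘ G n (sat n)) × (sat =O λ n → n * ⌊log₂ n ⌋)
theorem8 {k} G a b minimal bipartite (Na⊆Nb , Nb⊆Na) =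
    (λ n → proj₁ (minimum n))
  , (λ n → proj₁ (proj₂ (minimum n)))
  , 2 * k , 2 , λ n 2≤n → ≤-trans (proj₂ (proj₂ (minimum n)))
      (≤-trans (proj₂ (proj₂ (saturated n))) (bound n 2≤n))
  where
  open EdgeOrderedGraph G
  open MinimalEdge G minimal

  SparseSaturated : ℕ → ℕ → Set
  SparseSaturated n s =
    Σ[ H ∈ EdgeOrderedGraph n ] Saturatedₘ G H × EdgeOrderedGraph.edgeCount H ≤ s * n

  -- If `n ≤ L * k` there may be no room for the gadgets, but then every vertex is below `L * k` and
  -- any saturated graph meets the bound; one arises greedily from the empty graph.
  pad : ∀ L n → (∀ m → m ≤ n → SparseSaturated (L * k + m) (L * k)) → SparseSaturated n (L * k)
  pad L n sparse with ≤-total n (L * k)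
  ... | inj₁ n≤Lk = let E , sat = Greedy.saturate G {H = emptyGraph} emptyGraph-free in
    Greedy.Extension.host E , sat ,
    edgeCount≤ (Greedy.Extension.host E) (L * k) (λ {u} _ _ → <-≤-trans (toℕ<n u) n≤Lk)
  ... | inj₂ Lk≤n = subst (λ n → SparseSaturated n (L * k)) (m+[n∸m]≡n Lk≤n)
                      (sparse (n ∸ L * k) (m∸n≤m n (L * k)))

  saturated : ∀ n → SparseSaturated n (suc ⌊log₂ n ⌋ * k)
  saturated n with any? (λ c → T? (adj a c) ×-dec ¬? (c ≟ b))
  -- Since `c` lies in `N[ b ]` and differs from `b`, it closes a triangle. With `suc ⌊log₂ n ⌋`
  -- digits all of the at most `n` further vertices are told apart.
  ... | yes (c , ac , c≢b) = pad (suc ⌊log₂ n ⌋) n λ m m≤n →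
    Triangle.triangle-saturated bipartite {c} ac
      ([ flip contradiction c≢b , id ]′ (Na⊆Nb (inj₂ ac)))
      {suc ⌊log₂ n ⌋} (≤-trans m≤n (<⇒≤ (n<2^[1+⌊log₂n⌋] n)))
  ... | no none =
    -- One gadget suffices: `a` is played by every further vertex, and the condition on `b` is
    -- vacuous.
    let H , sat , count = pad 1 n λ m _ →
          Host.sparse-saturated 1 m (λ _ _ → a) (Isolated.host-free a-isolated m)
            (λ _ → zero , inj₁ ((λ _ → refl) , flip contradiction b-isolated))
    in H , sat , ≤-trans count (*-monoˡ-≤ n (*-monoˡ-≤ k (m≤m+n 1 ⌊log₂ n ⌋)))
    where
    a-isolated : ∀ {x} → ¬ G′.Adj a x
    a-isolated ax = let ax′ , ¬s = deleteEdge-adj⁻ graph a b ax in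
      none (_ , ax′ , λ x≡b → ¬s (inj₁ (refl , sym x≡b)))

    b-isolated : ∀ {x} → ¬ G′.Adj b x
    b-isolated bx with deleteEdge-adj⁻ graph a b bx
    -- A neighbour of `b` other than `a` would be a neighbour of `a` other than `b`.
    ... | bx′ , ¬s with Nb⊆Na (inj₂ bx′)
    ...   | inj₁ x≡a = ¬s (inj₂ (sym x≡a , refl))
    ...   | inj₂ ax  = none (_ , ax , λ { refl → adj-irrefl bx′ })

  minimum : ∀ n → ∃[ m ] IsSatₘ G n m × m ≤ EdgeOrderedGraph.edgeCount (proj₁ (saturated n))
  minimum n = satₘ-exists G {proj₁ (saturated n)} (proj₁ (proj₂ (saturated n)))

  bound : ∀ n → 2 ≤ n → suc ⌊log₂ n ⌋ * k * n ≤ 2 * k * (n * ⌊log₂ n ⌋)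
  bound n 2≤n = begin
    -- From `2 ≤ n` comes `1 ≤ l`, so `suc l ≤ l + l`; hence the threshold 2 and the constant
    -- `2 * k`.
    suc l * k * n        ≤⟨ *-monoˡ-≤ n (*-monoˡ-≤ k (+-monoˡ-≤ l (⌊log₂⌋-mono-≤ 2≤n))) ⟩
    (l + l) * k * n      ≡⟨ rearrange l k n ⟩
    2 * k * (n * l)      ∎
    where
    open ≤-Reasoning
    l : ℕ
    l = ⌊log₂ n ⌋
    rearrange : ∀ l k n → (l + l) * k * n ≡ 2 * k * (n * l)
    rearrange = solve-∀
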